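{- For infinitely many $n\in\mathbb{N}$ there exist matroids $M=(E,\mathcal{I})$ and $M'=(E,\mathcal{I}')$ over the same ground set $E$ with $|E|=n$, and a weight function $w:E\to\{0,1\}$, together with a vertex $x^*$ of the polytope $\{x: x\in P_B(M)\cap P_B(M'),\ w^{\mathsf T}x=1\}$, such that there is a unique common basis $B$ of $M$ and $M'$ with $w(B)=1$, and this $B$ satisfies $\|x^*-\chi(B)\|_1=\tfrac34 n$.
   Context: $P_B(M)$ denotes the base polytope of $M$ (convex hull of characteristic vectors of bases of $M$) in $\mathbb{R}^E$; $\chi(B)$ is the characteristic vector of $B$; $w(S)=\sum_{e\in S}w(e)$; a common basis is a set that is a basis of both matroids. -}

module Defs where

open import Data.Bool using (if_then_else_)
open import Data.Fin using (Fin; toℕ)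
open import Data.Fin.Subset using (Subset; _∈_; _∉_; _⊆_; _∪_; ⁅_⁆; ∣_∣) renaming (⊥ to ∅)
open import Data.Integer using (+_)
open import Data.Nat as ℕ using (ℕ)
import Data.Nat.Properties as ℕ
open import Data.Product using (Σ-syntax; ∃-syntax; _×_; _,_)
open import Data.Rational as ℚ using (ℚ; 0ℚ; 1ℚ)
import Data.Rational.Properties as ℚ
open import Data.Rational.Solver using (module +-*-Solver)
open import Data.Sum using (inj₁; inj₂)
open import Data.Vec using (lookup)
open import Data.Vec.Functional using (Vector; foldr)
open import Level using (0ℓ)
open import Relation.Binary.PropositionalEquality
  using (_≡_; refl; sym; trans; cong; cong₂; subst)
open import Relation.Unary using (Pred; _∩_)

-- Real numbers, as Cauchy sequences of rationals. Equality of reals is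
-- the relation _≈_, not propositional equality.

IsCauchy : (ℕ → ℚ) → Set
IsCauchy x = ∀ ε → 0ℚ ℚ.< ε → ∃[ N ] (∀ m n → N ℕ.≤ m → N ℕ.≤ n → ℚ.∣ x m ℚ.- x n ∣ ℚ.< ε)

record ℝ : Set where
  constructor mkℝ
  field
    seq    : ℕ → ℚ
    cauchy : IsCauchy seq

open ℝ public

infix 4 _≈_ _≤_ _<_

_≈_ : ℝ → ℝ → Set
x ≈ y = ∀ ε → 0ℚ ℚ.< ε → ∃[ N ] (∀ n → N ℕ.≤ n → ℚ.∣ seq x n ℚ.- seq y n ∣ ℚ.< ε)

_≤_ : ℝ → ℝ → Set
x ≤ y = ∀ ε → 0ℚ ℚ.< ε → ∃[ N ] (∀ n → N ℕ.≤ n → seq x n ℚ.< seq y n ℚ.+ ε)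

_<_ : ℝ → ℝ → Set
x < y = ∃[ ε ] (0ℚ ℚ.< ε × ∃[ N ] (∀ n → N ℕ.≤ n → seq x n ℚ.+ ε ℚ.< seq y n))

private abstract
  open +-*-Solver using (solve; _:=_; _:+_; _:*_; _:-_; :-_)

  scale : ∀ K ε → 0ℚ ℚ.< K → 0ℚ ℚ.< ε → ∃[ δ ] (0ℚ ℚ.< δ × K ℚ.* δ ≡ ε)
  scale K ε 0<K 0<ε = K⁻¹ ℚ.* ε ,
    ℚ.positive⁻¹ (K⁻¹ ℚ.* ε) {{ℚ.pos*pos⇒pos K⁻¹ {{ℚ.1/pos⇒pos K}} ε {{ℚ.positive 0<ε}}}} ,
    trans (sym (ℚ.*-assoc K K⁻¹ ε))
      (trans (cong (ℚ._* ε) (ℚ.*-inverseʳ K {{K≢0}})) (ℚ.*-identityˡ ε))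
    where
    instance
      K>0 : ℚ.Positive K
      K>0 = ℚ.positive 0<K
    K≢0 : ℚ.NonZero K
    K≢0 = ℚ.pos⇒nonZero K
    K⁻¹ : ℚ
    K⁻¹ = (ℚ.1/ K) {{K≢0}}

  dominated : ∀ (x y : ℝ) (z : ℕ → ℚ) K L → 0ℚ ℚ.< K → 0ℚ ℚ.< L → ∀ N →
    (∀ m n → N ℕ.≤ m → N ℕ.≤ n →
      ℚ.∣ z m ℚ.- z n ∣ ℚ.≤
      K ℚ.* ℚ.∣ seq x m ℚ.- seq x n ∣ ℚ.+ L ℚ.* ℚ.∣ seq y m ℚ.- seq y n ∣) →
    IsCauchy z
  dominated x y z K L 0<K 0<L N bound ε 0<ε
    with scale (K ℚ.+ L) ε (ℚ.+-mono-< 0<K 0<L) 0<ε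
  ... | δ , 0<δ , [K+L]δ≡ε with cauchy x δ 0<δ | cauchy y δ 0<δ
  ... | N₁ , p | N₂ , q = N ℕ.⊔ (N₁ ℕ.⊔ N₂) , close
    where
    open ℚ.≤-Reasoning
    close : ∀ m n → N ℕ.⊔ (N₁ ℕ.⊔ N₂) ℕ.≤ m → N ℕ.⊔ (N₁ ℕ.⊔ N₂) ℕ.≤ n →
            ℚ.∣ z m ℚ.- z n ∣ ℚ.< ε
    close m n hm hn = begin-strict
      ℚ.∣ z m ℚ.- z n ∣
        ≤⟨ bound m n (ℕ.m⊔n≤o⇒m≤o N _ hm) (ℕ.m⊔n≤o⇒m≤o N _ hn) ⟩
      K ℚ.* ℚ.∣ seq x m ℚ.- seq x n ∣ ℚ.+ L ℚ.* ℚ.∣ seq y m ℚ.- seq y n ∣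
        <⟨ ℚ.+-mono-<
             (ℚ.*-monoʳ-<-pos K {{ℚ.positive 0<K}}
               (p m n (ℕ.m⊔n≤o⇒m≤o N₁ N₂ hm′) (ℕ.m⊔n≤o⇒m≤o N₁ N₂ hn′)))
             (ℚ.*-monoʳ-<-pos L {{ℚ.positive 0<L}}
               (q m n (ℕ.m⊔n≤o⇒n≤o N₁ N₂ hm′) (ℕ.m⊔n≤o⇒n≤o N₁ N₂ hn′))) ⟩
      K ℚ.* δ ℚ.+ L ℚ.* δ
        ≡⟨ ℚ.*-distribʳ-+ δ K L ⟨
      (K ℚ.+ L) ℚ.* δ
        ≡⟨ [K+L]δ≡ε ⟩
      ε ∎
      where
      hm′ : N₁ ℕ.⊔ N₂ ℕ.≤ m
      hm′ = ℕ.m⊔n≤o⇒n≤o N _ hm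
      hn′ : N₁ ℕ.⊔ N₂ ℕ.≤ n
      hn′ = ℕ.m⊔n≤o⇒n≤o N _ hn

  ∣p∣-∣q∣≤∣p-q∣ : ∀ p q → ℚ.∣ p ∣ ℚ.- ℚ.∣ q ∣ ℚ.≤ ℚ.∣ p ℚ.- q ∣
  ∣p∣-∣q∣≤∣p-q∣ p q = begin
    ℚ.∣ p ∣ ℚ.- ℚ.∣ q ∣
      ≡⟨ cong (λ r → ℚ.∣ r ∣ ℚ.- ℚ.∣ q ∣) (solve 2 (λ p q → p := (p :- q) :+ q) refl p q) ⟩
    ℚ.∣ p ℚ.- q ℚ.+ q ∣ ℚ.- ℚ.∣ q ∣
      ≤⟨ ℚ.+-monoˡ-≤ (ℚ.- ℚ.∣ q ∣) (ℚ.∣p+q∣≤∣p∣+∣q∣ (p ℚ.- q) q) ⟩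
    ℚ.∣ p ℚ.- q ∣ ℚ.+ ℚ.∣ q ∣ ℚ.- ℚ.∣ q ∣
      ≡⟨ solve 2 (λ u v → (u :+ v) :- v := u) refl ℚ.∣ p ℚ.- q ∣ ℚ.∣ q ∣ ⟩
    ℚ.∣ p ℚ.- q ∣ ∎
    where open ℚ.≤-Reasoning

  -‿flip : ∀ p q → ℚ.- (p ℚ.- q) ≡ q ℚ.- p
  -‿flip = solve 2 (λ p q → :- (p :- q) := q :- p) refl

  ∣∣p∣-∣q∣∣≤∣p-q∣ : ∀ p q → ℚ.∣ ℚ.∣ p ∣ ℚ.- ℚ.∣ q ∣ ∣ ℚ.≤ ℚ.∣ p ℚ.- q ∣
  ∣∣p∣-∣q∣∣≤∣p-q∣ p q with ℚ.∣p∣≡p∨∣p∣≡-p (ℚ.∣ p ∣ ℚ.- ℚ.∣ q ∣)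
  ... | inj₁ eq = begin
    ℚ.∣ ℚ.∣ p ∣ ℚ.- ℚ.∣ q ∣ ∣  ≡⟨ eq ⟩
    ℚ.∣ p ∣ ℚ.- ℚ.∣ q ∣        ≤⟨ ∣p∣-∣q∣≤∣p-q∣ p q ⟩
    ℚ.∣ p ℚ.- q ∣              ∎
    where open ℚ.≤-Reasoning
  ... | inj₂ eq = begin
    ℚ.∣ ℚ.∣ p ∣ ℚ.- ℚ.∣ q ∣ ∣  ≡⟨ eq ⟩
    ℚ.- (ℚ.∣ p ∣ ℚ.- ℚ.∣ q ∣)  ≡⟨ -‿flip ℚ.∣ p ∣ ℚ.∣ q ∣ ⟩
    ℚ.∣ q ∣ ℚ.- ℚ.∣ p ∣        ≤⟨ ∣p∣-∣q∣≤∣p-q∣ q p ⟩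
    ℚ.∣ q ℚ.- p ∣              ≡⟨ cong ℚ.∣_∣ (-‿flip p q) ⟨
    ℚ.∣ ℚ.- (p ℚ.- q) ∣        ≡⟨ ℚ.∣-p∣≡∣p∣ (p ℚ.- q) ⟩
    ℚ.∣ p ℚ.- q ∣              ∎
    where open ℚ.≤-Reasoning

  EventuallyBounded : (ℕ → ℚ) → Set
  EventuallyBounded x = ∃[ N ] ∃[ K ] (0ℚ ℚ.< K × (∀ n → N ℕ.≤ n → ℚ.∣ x n ∣ ℚ.≤ K))

  bounded : ∀ x → EventuallyBounded (seq x)
  bounded x with cauchy x 1ℚ (ℚ.positive⁻¹ 1ℚ)
  ... | N , p = N , 1ℚ ℚ.+ ℚ.∣ seq x N ∣ ,
    ℚ.+-mono-<-≤ (ℚ.positive⁻¹ 1ℚ) (ℚ.0≤∣p∣ (seq x N)) , bound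
    where
    open ℚ.≤-Reasoning
    bound : ∀ n → N ℕ.≤ n → ℚ.∣ seq x n ∣ ℚ.≤ 1ℚ ℚ.+ ℚ.∣ seq x N ∣
    bound n N≤n = begin
      ℚ.∣ seq x n ∣
        ≡⟨ cong ℚ.∣_∣ (solve 2 (λ a b → a := (a :- b) :+ b) refl (seq x n) (seq x N)) ⟩
      ℚ.∣ seq x n ℚ.- seq x N ℚ.+ seq x N ∣
        ≤⟨ ℚ.∣p+q∣≤∣p∣+∣q∣ (seq x n ℚ.- seq x N) (seq x N) ⟩
      ℚ.∣ seq x n ℚ.- seq x N ∣ ℚ.+ ℚ.∣ seq x N ∣
        ≤⟨ ℚ.+-monoˡ-≤ ℚ.∣ seq x N ∣ (ℚ.<⇒≤ (p n N N≤n ℕ.≤-refl)) ⟩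
      1ℚ ℚ.+ ℚ.∣ seq x N ∣ ∎

  const-cauchy : ∀ q → IsCauchy (λ _ → q)
  const-cauchy q ε 0<ε = 0 , λ _ _ _ _ →
    subst (λ r → r ℚ.< ε) (sym (cong ℚ.∣_∣ (ℚ.+-inverseʳ q))) 0<ε

  neg-cauchy : ∀ x → IsCauchy (λ n → ℚ.- seq x n)
  neg-cauchy x ε 0<ε with cauchy x ε 0<ε
  ... | N , p = N , λ m n hm hn →
    subst (λ r → r ℚ.< ε)
      (trans (sym (ℚ.∣-p∣≡∣p∣ (seq x m ℚ.- seq x n)))
             (cong ℚ.∣_∣ (ℚ.neg-distrib-+ (seq x m) (ℚ.- seq x n))))
      (p m n hm hn)

  abs-cauchy : ∀ x → IsCauchy (λ n → ℚ.∣ seq x n ∣)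
  abs-cauchy x ε 0<ε with cauchy x ε 0<ε
  ... | N , p = N , λ m n hm hn →
    ℚ.≤-<-trans (∣∣p∣-∣q∣∣≤∣p-q∣ (seq x m) (seq x n)) (p m n hm hn)

  +-cauchy : ∀ x y → IsCauchy (λ n → seq x n ℚ.+ seq y n)
  +-cauchy x y =
    dominated x y (λ n → seq x n ℚ.+ seq y n) 1ℚ 1ℚ (ℚ.positive⁻¹ 1ℚ) (ℚ.positive⁻¹ 1ℚ) 0
      (λ m n _ _ → +-bound (seq x m) (seq y m) (seq x n) (seq y n))
    where
    open ℚ.≤-Reasoning
    +-bound : ∀ a b c d →
      ℚ.∣ (a ℚ.+ b) ℚ.- (c ℚ.+ d) ∣ ℚ.≤ 1ℚ ℚ.* ℚ.∣ a ℚ.- c ∣ ℚ.+ 1ℚ ℚ.* ℚ.∣ b ℚ.- d ∣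
    +-bound a b c d = begin
      ℚ.∣ (a ℚ.+ b) ℚ.- (c ℚ.+ d) ∣
        ≡⟨ cong ℚ.∣_∣ (solve 4 (λ a b c d →
             (a :+ b) :- (c :+ d) := (a :- c) :+ (b :- d)) refl a b c d) ⟩
      ℚ.∣ (a ℚ.- c) ℚ.+ (b ℚ.- d) ∣
        ≤⟨ ℚ.∣p+q∣≤∣p∣+∣q∣ (a ℚ.- c) (b ℚ.- d) ⟩
      ℚ.∣ a ℚ.- c ∣ ℚ.+ ℚ.∣ b ℚ.- d ∣
        ≡⟨ cong₂ ℚ._+_ (ℚ.*-identityˡ ℚ.∣ a ℚ.- c ∣) (ℚ.*-identityˡ ℚ.∣ b ℚ.- d ∣) ⟨
      1ℚ ℚ.* ℚ.∣ a ℚ.- c ∣ ℚ.+ 1ℚ ℚ.* ℚ.∣ b ℚ.- d ∣ ∎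

  *-cauchy : ∀ x y → IsCauchy (λ n → seq x n ℚ.* seq y n)
  *-cauchy x y = via (bounded x) (bounded y)
    where
    open ℚ.≤-Reasoning

    *-bound : ∀ a b c d {K L} → ℚ.∣ b ∣ ℚ.≤ K → ℚ.∣ c ∣ ℚ.≤ L →
      ℚ.∣ a ℚ.* b ℚ.- c ℚ.* d ∣ ℚ.≤ K ℚ.* ℚ.∣ a ℚ.- c ∣ ℚ.+ L ℚ.* ℚ.∣ b ℚ.- d ∣
    *-bound a b c d {K} {L} ∣b∣≤K ∣c∣≤L = begin
      ℚ.∣ a ℚ.* b ℚ.- c ℚ.* d ∣
        ≡⟨ cong ℚ.∣_∣ (solve 4 (λ a b c d →
             a :* b :- c :* d := b :* (a :- c) :+ c :* (b :- d)) refl a b c d) ⟩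
      ℚ.∣ b ℚ.* (a ℚ.- c) ℚ.+ c ℚ.* (b ℚ.- d) ∣
        ≤⟨ ℚ.∣p+q∣≤∣p∣+∣q∣ (b ℚ.* (a ℚ.- c)) (c ℚ.* (b ℚ.- d)) ⟩
      ℚ.∣ b ℚ.* (a ℚ.- c) ∣ ℚ.+ ℚ.∣ c ℚ.* (b ℚ.- d) ∣
        ≡⟨ cong₂ ℚ._+_ (ℚ.∣p*q∣≡∣p∣*∣q∣ b (a ℚ.- c)) (ℚ.∣p*q∣≡∣p∣*∣q∣ c (b ℚ.- d)) ⟩
      ℚ.∣ b ∣ ℚ.* ℚ.∣ a ℚ.- c ∣ ℚ.+ ℚ.∣ c ∣ ℚ.* ℚ.∣ b ℚ.- d ∣
        ≤⟨ ℚ.+-mono-≤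
             (ℚ.*-monoʳ-≤-nonNeg ℚ.∣ a ℚ.- c ∣ {{ℚ.∣-∣-nonNeg (a ℚ.- c)}} ∣b∣≤K)
             (ℚ.*-monoʳ-≤-nonNeg ℚ.∣ b ℚ.- d ∣ {{ℚ.∣-∣-nonNeg (b ℚ.- d)}} ∣c∣≤L) ⟩
      K ℚ.* ℚ.∣ a ℚ.- c ∣ ℚ.+ L ℚ.* ℚ.∣ b ℚ.- d ∣ ∎

    via : EventuallyBounded (seq x) → EventuallyBounded (seq y) →
          IsCauchy (λ n → seq x n ℚ.* seq y n)
    via (N₁ , L , 0<L , p) (N₂ , K , 0<K , q) =
      dominated x y (λ n → seq x n ℚ.* seq y n) K L 0<K 0<L (N₁ ℕ.⊔ N₂)
        (λ m n hm hn → *-bound (seq x m) (seq y m) (seq x n) (seq y n)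
          (q m (ℕ.m⊔n≤o⇒n≤o N₁ N₂ hm)) (p n (ℕ.m⊔n≤o⇒m≤o N₁ N₂ hn)))

fromℚ : ℚ → ℝ
fromℚ q = mkℝ (λ _ → q) (const-cauchy q)

fromℕ : ℕ → ℝ
fromℕ n = fromℚ (+ n ℚ./ 1)

0ℝ 1ℝ : ℝ
0ℝ = fromℚ 0ℚ
1ℝ = fromℚ 1ℚ

infixl 6 _+_ _-_
infixl 7 _*_
infix  8 -_

_+_ : ℝ → ℝ → ℝ
x + y = mkℝ (λ n → seq x n ℚ.+ seq y n) (+-cauchy x y)

-_ : ℝ → ℝ
- x = mkℝ (λ n → ℚ.- seq x n) (neg-cauchy x)

_-_ : ℝ → ℝ → ℝ
x - y = x + (- y)

_*_ : ℝ → ℝ → ℝ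
x * y = mkℝ (λ n → seq x n ℚ.* seq y n) (*-cauchy x y)

∣_∣ᴿ : ℝ → ℝ
∣ x ∣ᴿ = mkℝ (λ n → ℚ.∣ seq x n ∣) (abs-cauchy x)

infix 4 _≋_

_≋_ : ∀ {n} → Vector ℝ n → Vector ℝ n → Set
x ≋ y = ∀ e → x e ≈ y e

∑ : ∀ {n} → Vector ℝ n → ℝ
∑ = foldr _+_ 0ℝ

‖_‖₁ : ∀ {n} → Vector ℝ n → ℝ
‖ x ‖₁ = ∑ λ e → ∣ x e ∣ᴿ

_⊖_ : ∀ {n} → Vector ℝ n → Vector ℝ n → Vector ℝ n
(x ⊖ y) e = x e - y e

ConvexHull : ∀ {n} → Pred (Vector ℝ n) 0ℓ → Pred (Vector ℝ n) 0ℓ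
ConvexHull {n} S x =
  ∃[ k ] Σ[ c ∈ Vector ℝ k ] Σ[ v ∈ Vector (Vector ℝ n) k ]
    ( (∀ i → 0ℝ ≤ c i)
    × ∑ c ≈ 1ℝ
    × (∀ i → S (v i))
    × x ≋ (λ e → ∑ λ i → c i * v i e))

-- Vertices in the sense of extreme points.
IsVertex : ∀ {n} → Pred (Vector ℝ n) 0ℓ → Pred (Vector ℝ n) 0ℓ
IsVertex P x = P x ×
  (∀ y z t → P y → P z → 0ℝ < t → t < 1ℝ →
    x ≋ (λ e → (1ℝ - t) * y e + t * z e) → y ≋ x × z ≋ x)

-- The ground set E with |E| = n is Fin n.

record Matroid (n : ℕ) : Set₁ where
  field
    Indep    : Pred (Subset n) 0ℓ
    ∅-indep  : Indep ∅
    ⊆-closed : ∀ {A B} → A ⊆ B → Indep B → Indep A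
    augment  : ∀ {A B} → Indep A → Indep B → ∣ A ∣ ℕ.< ∣ B ∣ →
               ∃[ e ] (e ∈ B × e ∉ A × Indep (A ∪ ⁅ e ⁆))

Weight : ℕ → Set
Weight n = Vector (Fin 2) n

module _ {n : ℕ} where

  IsBasis : Matroid n → Pred (Subset n) 0ℓ
  IsBasis M B = Indep B × (∀ {C} → Indep C → B ⊆ C → C ≡ B)
    where open Matroid M

  IsCommonBasis : Matroid n → Matroid n → Pred (Subset n) 0ℓ
  IsCommonBasis M M′ = IsBasis M ∩ IsBasis M′

  χ : Subset n → Vector ℝ n
  χ S e = if lookup S e then 1ℝ else 0ℝ

  BasePolytope : Matroid n → Pred (Vector ℝ n) 0ℓ
  BasePolytope M = ConvexHull (λ p → ∃[ B ] (IsBasis M B × p ≋ χ B))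

  weight : Weight n → Subset n → ℕ
  weight w S = foldr ℕ._+_ 0 (λ e → if lookup S e then toℕ (w e) else 0)

  _ᵀ_ : Weight n → Vector ℝ n → ℝ
  w ᵀ x = ∑ λ e → fromℕ (toℕ (w e)) * x e

  WeightSlice : Matroid n → Matroid n → Weight n → Pred (Vector ℝ n) 0ℓ
  WeightSlice M M′ w x = BasePolytope M x × BasePolytope M′ x × w ᵀ x ≈ 1ℝ

{-# OPTIONS --safe #-}

-- Let n = 4m. The elements are X_i, Y_i, Z_i, W_i for i in Z/m. The first
-- matroid has as bases the transversals of the pairs {X_i, Y_i}, {Z_i, W_i},
-- the second those of the pairs {X_{i-1}, Y_i}, {Z_{i-1}, W_i}. In other words,
-- the common bases are the perfect matchings of two disjoint cycles of length
-- 2m: the four sets X ∪ Z, Y ∪ Z, X ∪ W, Y ∪ W. Put weight 1 on Y_0, Y_1, W_0,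
-- so that their weights are 0, 2, 1, 3 and B = X ∪ W. The point x* is the
-- midpoint of X ∪ Z and Y ∪ Z; each of the 2m coordinates in X ∪ Y contributes
-- 1/2 to its distance from B, each of the 2m others contributes 1.
--
-- x* is a vertex: if x* lies strictly between y and z, nonnegativity and
-- x*(W_0) = 0 give y(W_0) = z(W_0) = 0. Both y and z sum to 1 on every pair of
-- either matroid, so they are constant on each of X, Y, Z, W; their weight 1
-- then forces the common value 1/2 on Y, and hence all coordinates.

module Submission where

open import Data.Integer using (+_)
open import Data.Nat using (ℕ; _≤_)
open import Data.Product using (Σ-syntax; ∃-syntax; ∃!; _×_; proj₁)
open import Data.Rational using (_/_)
open import Data.Vec.Functional using (Vector)
open import Relation.Binary.PropositionalEquality using (_≡_)
open import Defs hiding (_≤_)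

open import Data.Bool using (Bool; true; false; not; if_then_else_)
open import Data.Bool.Properties using (not-involutive; if-eta)
open import Data.Fin using (Fin; zero; suc; inject₁; toℕ; combine; remQuot; quotient; remainder; _↑ʳ_)
import Data.Fin as Fin
open import Data.Fin.Induction using (<-weakInduction)
open import Data.Fin.Properties
  using (any?; inject₁-injective; fromℕ≢inject₁; remQuot-combine; combine-remQuot; combine-surjective)
open import Data.Fin.Relation.Unary.Top using (view; ‵fromℕ; ‵inject₁)
open import Data.Fin.Subset using (Subset; _∈_; _∉_; _⊆_; _⊂_; _∪_; ⁅_⁆; ∣_∣; inside; outside)
  renaming (_-_ to _∖_)
open import Data.Fin.Subset.Induction using (⊂-wellFounded)
open import Data.Fin.Subset.Properties
import Data.Integer as ℤ
import Data.Integer.Properties as ℤ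
open import Data.Nat as ℕ using (zero; suc; z≤n; s≤s)
import Data.Nat.Properties as ℕ
open import Data.Product using (_,_; proj₂)
import Data.Product.Properties as Product
open import Data.Rational as ℚ using (ℚ; 0ℚ; 1ℚ; ½)
import Data.Rational.Properties as ℚ
open import Data.Rational.Solver using (module +-*-Solver)
import Data.Rational.Unnormalised as ℚᵘ
import Data.Rational.Unnormalised.Properties as ℚᵘ
open import Data.Sum using (_⊎_; inj₁; inj₂)
open import Data.Vec using (lookup; tabulate; _∷_; there)
open import Data.Vec.Functional using (foldr)
open import Data.Vec.Properties
  using ([]=⇒lookup; lookup⇒[]=; lookup∘tabulate; tabulate∘lookup; tabulate-cong)
open import Defs using () renaming (_≤_ to _≤ᴿ_)
open import Function using (_∘_; id)
open import Function.Definitions using (Injective; StrictlySurjective)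
open import Induction.WellFounded using (Acc; acc)
open import Relation.Binary.Bundles using (Setoid)
open import Relation.Binary.Definitions using (DecidableEquality)
open import Relation.Binary.PropositionalEquality
  using (_≢_; refl; sym; trans; cong; cong₂; subst; module ≡-Reasoning)
import Relation.Binary.Reasoning.Setoid as SetoidReasoning
open import Relation.Nullary using (¬_; Dec; yes; no; ¬?; contradiction)
open import Relation.Nullary.Decidable using (_×-dec_)

open +-*-Solver using (solve; _:=_; _:+_; _:*_; _:-_; :-_)

-- Cauchy reals

-- `x ≈ y` is by definition `Null` of the termwise difference, so the laws of `_≈_` become closure
-- properties of null sequences followed by ring identities in `ℚ`.
Null : (ℕ → ℚ) → Set
Null u = ∀ ε → 0ℚ ℚ.< ε → ∃[ N ] (∀ n → N ℕ.≤ n → ℚ.∣ u n ∣ ℚ.< ε)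

abstract
  halve : ∀ {ε} → 0ℚ ℚ.< ε → ∃[ δ ] (0ℚ ℚ.< δ × δ ℚ.+ δ ≡ ε)
  halve {ε} 0<ε = ½ ℚ.* ε ,
    subst (ℚ._< ½ ℚ.* ε) (ℚ.*-zeroʳ ½) (ℚ.*-monoʳ-<-pos ½ 0<ε) ,
    trans (sym (ℚ.*-distribʳ-+ ε ½ ½)) (ℚ.*-identityˡ ε)

  divide : ∀ K ε → 0ℚ ℚ.< K → 0ℚ ℚ.< ε → ∃[ δ ] (0ℚ ℚ.< δ × K ℚ.* δ ≡ ε)
  divide K ε 0<K 0<ε = K⁻¹ ℚ.* ε ,
    ℚ.positive⁻¹ _ {{ℚ.pos*pos⇒pos K⁻¹ {{ℚ.1/pos⇒pos K}} ε {{ℚ.positive 0<ε}}}} ,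
    trans (sym (ℚ.*-assoc K K⁻¹ ε))
      (trans (cong (ℚ._* ε) (ℚ.*-inverseʳ K {{ℚ.pos⇒nonZero K}})) (ℚ.*-identityˡ ε))
    where
    instance
      K>0 : ℚ.Positive K
      K>0 = ℚ.positive 0<K
    K⁻¹ : ℚ
    K⁻¹ = (ℚ.1/ K) {{ℚ.pos⇒nonZero K}}

Null-resp : ∀ {u v} → (∀ n → u n ≡ v n) → Null u → Null v
Null-resp u≡v null ε 0<ε with null ε 0<ε
... | N , p = N , λ n N≤n → subst (λ r → ℚ.∣ r ∣ ℚ.< ε) (u≡v n) (p n N≤n)

Null-0 : Null (λ _ → 0ℚ)
Null-0 ε 0<ε = 0 , λ _ _ → 0<ε

Null-neg : ∀ {u} → Null u → Null (λ n → ℚ.- u n)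
Null-neg {u} null ε 0<ε with null ε 0<ε
... | N , p = N , λ n N≤n → subst (ℚ._< ε) (sym (ℚ.∣-p∣≡∣p∣ (u n))) (p n N≤n)

Null-+ : ∀ {u v} → Null u → Null v → Null (λ n → u n ℚ.+ v n)
Null-+ {u} {v} null-u null-v ε 0<ε with halve 0<ε
... | δ , 0<δ , δ+δ≡ε with null-u δ 0<δ | null-v δ 0<δ
... | N₁ , p | N₂ , q = N₁ ℕ.⊔ N₂ , λ n hn → begin-strict
  ℚ.∣ u n ℚ.+ v n ∣          ≤⟨ ℚ.∣p+q∣≤∣p∣+∣q∣ (u n) (v n) ⟩
  ℚ.∣ u n ∣ ℚ.+ ℚ.∣ v n ∣    <⟨ ℚ.+-mono-< (p n (ℕ.m⊔n≤o⇒m≤o N₁ N₂ hn)) (q n (ℕ.m⊔n≤o⇒n≤o N₁ N₂ hn)) ⟩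
  δ ℚ.+ δ                    ≡⟨ δ+δ≡ε ⟩
  ε                          ∎
  where open ℚ.≤-Reasoning

abstract
  bounded : ∀ x → ∃[ N ] ∃[ K ] (0ℚ ℚ.< K × (∀ n → N ℕ.≤ n → ℚ.∣ seq x n ∣ ℚ.≤ K))
  bounded x with cauchy x 1ℚ (ℚ.positive⁻¹ 1ℚ)
  ... | N , p = N , 1ℚ ℚ.+ ℚ.∣ seq x N ∣ ,
    ℚ.+-mono-<-≤ (ℚ.positive⁻¹ 1ℚ) (ℚ.0≤∣p∣ (seq x N)) , λ n N≤n → begin
      ℚ.∣ seq x n ∣
        ≡⟨ cong ℚ.∣_∣ (solve 2 (λ a b → a := (a :- b) :+ b) refl (seq x n) (seq x N)) ⟩
      ℚ.∣ seq x n ℚ.- seq x N ℚ.+ seq x N ∣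
        ≤⟨ ℚ.∣p+q∣≤∣p∣+∣q∣ (seq x n ℚ.- seq x N) (seq x N) ⟩
      ℚ.∣ seq x n ℚ.- seq x N ∣ ℚ.+ ℚ.∣ seq x N ∣
        ≤⟨ ℚ.+-monoˡ-≤ ℚ.∣ seq x N ∣ (ℚ.<⇒≤ (p n N N≤n ℕ.≤-refl)) ⟩
      1ℚ ℚ.+ ℚ.∣ seq x N ∣ ∎
    where open ℚ.≤-Reasoning

-- A Cauchy sequence is eventually bounded by some `K`, so it suffices to ask `u` for a tolerance
-- `δ` with `K ℚ.* δ ≡ ε`.
Null-* : ∀ c {u} → Null u → Null (λ n → seq c n ℚ.* u n)
Null-* c {u} null ε 0<ε with bounded c
... | N₁ , K , 0<K , bound with divide K ε 0<K 0<ε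
... | δ , 0<δ , Kδ≡ε with null δ 0<δ
... | N₂ , p = N₁ ℕ.⊔ N₂ , λ n hn → begin-strict
  ℚ.∣ seq c n ℚ.* u n ∣
    ≡⟨ ℚ.∣p*q∣≡∣p∣*∣q∣ (seq c n) (u n) ⟩
  ℚ.∣ seq c n ∣ ℚ.* ℚ.∣ u n ∣
    ≤⟨ ℚ.*-monoʳ-≤-nonNeg ℚ.∣ u n ∣ {{ℚ.∣-∣-nonNeg (u n)}} (bound n (ℕ.m⊔n≤o⇒m≤o N₁ N₂ hn)) ⟩
  K ℚ.* ℚ.∣ u n ∣
    <⟨ ℚ.*-monoʳ-<-pos K {{ℚ.positive 0<K}} (p n (ℕ.m⊔n≤o⇒n≤o N₁ N₂ hn)) ⟩
  K ℚ.* δ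
    ≡⟨ Kδ≡ε ⟩
  ε ∎
  where open ℚ.≤-Reasoning

pointwise : ∀ {x y} → (∀ n → seq x n ≡ seq y n) → x ≈ y
pointwise {x} {y} x≡y = Null-resp
  (λ n → sym (trans (cong (ℚ._- seq y n) (x≡y n)) (ℚ.+-inverseʳ (seq y n)))) Null-0

ℝ-setoid : Setoid _ _
ℝ-setoid = record
  { Carrier = ℝ
  ; _≈_ = _≈_
  ; isEquivalence = record
    { refl  = λ {x} → pointwise {x} {x} (λ _ → refl)
    ; sym   = λ {x} {y} x≈y → Null-resp
        (λ n → solve 2 (λ a b → :- (a :- b) := b :- a) refl (seq x n) (seq y n)) (Null-neg x≈y)
    ; trans = λ {x} {y} {z} x≈y y≈z → Null-resp
        (λ n → solve 3 (λ a b c → (a :- b) :+ (b :- c) := a :- c) refl (seq x n) (seq y n) (seq z n))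
        (Null-+ x≈y y≈z)
    }
  }

open Setoid ℝ-setoid using () renaming (refl to ≈-refl; sym to ≈-sym; trans to ≈-trans)

+-cong : ∀ {x y u v} → x ≈ y → u ≈ v → x + u ≈ y + v
+-cong {x} {y} {u} {v} x≈y u≈v = Null-resp
  (λ n → solve 4 (λ a b c d → (a :- b) :+ (c :- d) := (a :+ c) :- (b :+ d)) refl
    (seq x n) (seq y n) (seq u n) (seq v n))
  (Null-+ x≈y u≈v)

*-congˡ : ∀ c {x y} → x ≈ y → c * x ≈ c * y
*-congˡ c {x} {y} x≈y = Null-resp
  (λ n → solve 3 (λ c a b → c :* (a :- b) := c :* a :- c :* b) refl (seq c n) (seq x n) (seq y n))
  (Null-* c x≈y)

p≤∣p∣ : ∀ p → p ℚ.≤ ℚ.∣ p ∣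
p≤∣p∣ p with ℚ.≤-total 0ℚ p
... | inj₁ 0≤p = ℚ.≤-reflexive (sym (ℚ.0≤p⇒∣p∣≡p 0≤p))
... | inj₂ p≤0 = ℚ.≤-trans p≤0 (ℚ.0≤∣p∣ p)

p-0≡p : ∀ p → p ℚ.- 0ℚ ≡ p
p-0≡p = ℚ.+-identityʳ

0≤-resp : ∀ {x y} → x ≈ y → 0ℝ ≤ᴿ x → 0ℝ ≤ᴿ y
0≤-resp {x} {y} x≈y 0≤x ε 0<ε with halve 0<ε
... | δ , 0<δ , δ+δ≡ε with x≈y δ 0<δ | 0≤x δ 0<δ
... | N₁ , p | N₂ , q = N₁ ℕ.⊔ N₂ , λ n hn → begin-strict
  0ℚ
    <⟨ q n (ℕ.m⊔n≤o⇒n≤o N₁ N₂ hn) ⟩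
  seq x n ℚ.+ δ
    ≡⟨ solve 3 (λ a b c → a :+ c := (a :- b) :+ (b :+ c)) refl (seq x n) (seq y n) δ ⟩
  (seq x n ℚ.- seq y n) ℚ.+ (seq y n ℚ.+ δ)
    <⟨ ℚ.+-monoˡ-< (seq y n ℚ.+ δ) (ℚ.≤-<-trans (p≤∣p∣ _) (p n (ℕ.m⊔n≤o⇒m≤o N₁ N₂ hn))) ⟩
  δ ℚ.+ (seq y n ℚ.+ δ)
    ≡⟨ solve 2 (λ b d → d :+ (b :+ d) := b :+ (d :+ d)) refl (seq y n) δ ⟩
  seq y n ℚ.+ (δ ℚ.+ δ)
    ≡⟨ cong (seq y n ℚ.+_) δ+δ≡ε ⟩
  seq y n ℚ.+ ε ∎
  where
  open ℚ.≤-Reasoning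

0≤-+ : ∀ {x y} → 0ℝ ≤ᴿ x → 0ℝ ≤ᴿ y → 0ℝ ≤ᴿ x + y
0≤-+ {x} {y} 0≤x 0≤y ε 0<ε with halve 0<ε
... | δ , 0<δ , δ+δ≡ε with 0≤x δ 0<δ | 0≤y δ 0<δ
... | N₁ , p | N₂ , q = N₁ ℕ.⊔ N₂ , λ n hn → begin-strict
  0ℚ
    <⟨ ℚ.+-mono-< (p n (ℕ.m⊔n≤o⇒m≤o N₁ N₂ hn)) (q n (ℕ.m⊔n≤o⇒n≤o N₁ N₂ hn)) ⟩
  (seq x n ℚ.+ δ) ℚ.+ (seq y n ℚ.+ δ)
    ≡⟨ solve 3 (λ a b d → (a :+ d) :+ (b :+ d) := (a :+ b) :+ (d :+ d)) refl (seq x n) (seq y n) δ ⟩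
  seq x n ℚ.+ seq y n ℚ.+ (δ ℚ.+ δ)
    ≡⟨ cong (seq x n ℚ.+ seq y n ℚ.+_) δ+δ≡ε ⟩
  seq x n ℚ.+ seq y n ℚ.+ ε ∎
  where open ℚ.≤-Reasoning

0≤-fromℚ : ∀ {q} → 0ℚ ℚ.≤ q → 0ℝ ≤ᴿ fromℚ q
0≤-fromℚ 0≤q ε 0<ε = 0 , λ _ _ → ℚ.+-mono-≤-< 0≤q 0<ε

-- Strict positivity fixes the sign of all late terms of `s`, so `0 < x + δ` may be multiplied by
-- `s` termwise; the excess `s * δ` is at most `K * δ`, which is `ε`.
0≤-* : ∀ {s x} → 0ℝ < s → 0ℝ ≤ᴿ x → 0ℝ ≤ᴿ s * x
0≤-* {s} {x} (η , 0<η , N₀ , η<s) 0≤x ε 0<ε with bounded s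
... | N₁ , K , 0<K , bound with divide K ε 0<K 0<ε
... | δ , 0<δ , Kδ≡ε with 0≤x δ 0<δ
... | N₂ , p = N₀ ℕ.⊔ (N₁ ℕ.⊔ N₂) , λ n hn → close n (ℕ.m⊔n≤o⇒m≤o N₀ _ hn)
    (ℕ.m⊔n≤o⇒m≤o N₁ N₂ (ℕ.m⊔n≤o⇒n≤o N₀ _ hn)) (ℕ.m⊔n≤o⇒n≤o N₁ N₂ (ℕ.m⊔n≤o⇒n≤o N₀ _ hn))
  where
  open ℚ.≤-Reasoning
  close : ∀ n → N₀ ℕ.≤ n → N₁ ℕ.≤ n → N₂ ℕ.≤ n → 0ℚ ℚ.< seq s n ℚ.* seq x n ℚ.+ ε
  close n h₀ h₁ h₂ = begin-strict
    0ℚ                                       ≡⟨ ℚ.*-zeroʳ (seq s n) ⟨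
    seq s n ℚ.* 0ℚ                           <⟨ ℚ.*-monoʳ-<-pos (seq s n) {{ℚ.positive 0<s}} (p n h₂) ⟩
    seq s n ℚ.* (seq x n ℚ.+ δ)              ≡⟨ ℚ.*-distribˡ-+ (seq s n) (seq x n) δ ⟩
    seq s n ℚ.* seq x n ℚ.+ seq s n ℚ.* δ    ≤⟨ ℚ.+-monoʳ-≤ (seq s n ℚ.* seq x n)
      (ℚ.*-monoʳ-≤-nonNeg δ {{ℚ.nonNegative (ℚ.<⇒≤ 0<δ)}}
        (subst (ℚ._≤ K) (ℚ.0≤p⇒∣p∣≡p (ℚ.<⇒≤ 0<s)) (bound n h₁))) ⟩
    seq s n ℚ.* seq x n ℚ.+ K ℚ.* δ          ≡⟨ cong (seq s n ℚ.* seq x n ℚ.+_) Kδ≡ε ⟩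
    seq s n ℚ.* seq x n ℚ.+ ε                ∎
    where
    0<s : 0ℚ ℚ.< seq s n
    0<s = ℚ.<-trans (subst (0ℚ ℚ.<_) (sym (ℚ.+-identityˡ η)) 0<η) (η<s n h₀)

∣p∣<q : ∀ {p q} → p ℚ.< q → ℚ.- q ℚ.< p → ℚ.∣ p ∣ ℚ.< q
∣p∣<q {p} {q} p<q -q<p with ℚ.∣p∣≡p∨∣p∣≡-p p
... | inj₁ eq = subst (ℚ._< q) (sym eq) p<q
... | inj₂ eq = subst (ℚ._< q) (sym eq)
  (subst (ℚ.- p ℚ.<_) (solve 1 (λ q → :- (:- q) := q) refl q) (ℚ.neg-antimono-< -q<p))

-- Late terms of `y` exceed `- δ`, so `x` stays below `(x + y) + δ` and hence below `δ + δ`; the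
-- lower bound comes from `0ℝ ≤ᴿ x`.
0≤+≈0⇒≈0 : ∀ {x y} → 0ℝ ≤ᴿ x → 0ℝ ≤ᴿ y → x + y ≈ 0ℝ → x ≈ 0ℝ
0≤+≈0⇒≈0 {x} {y} 0≤x 0≤y x+y≈0 ε 0<ε
  with halve 0<ε
... | δ , 0<δ , δ+δ≡ε with 0≤x ε 0<ε | 0≤y δ 0<δ | x+y≈0 δ 0<δ
... | N₁ , p | N₂ , q | N₃ , r = N₁ ℕ.⊔ (N₂ ℕ.⊔ N₃) , λ n hn →
  subst (λ a → ℚ.∣ a ∣ ℚ.< ε) (sym (p-0≡p (seq x n)))
    (∣p∣<q
      (upper n (ℕ.m⊔n≤o⇒m≤o N₂ N₃ (ℕ.m⊔n≤o⇒n≤o N₁ _ hn)) (ℕ.m⊔n≤o⇒n≤o N₂ N₃ (ℕ.m⊔n≤o⇒n≤o N₁ _ hn)))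
      (lower n (ℕ.m⊔n≤o⇒m≤o N₁ _ hn)))
  where
  open ℚ.≤-Reasoning
  lower : ∀ n → N₁ ℕ.≤ n → ℚ.- ε ℚ.< seq x n
  lower n h = begin-strict
    ℚ.- ε                      ≡⟨ ℚ.+-identityˡ (ℚ.- ε) ⟨
    0ℚ ℚ.- ε                   <⟨ ℚ.+-monoˡ-< (ℚ.- ε) (p n h) ⟩
    seq x n ℚ.+ ε ℚ.- ε        ≡⟨ solve 2 (λ a e → (a :+ e) :- e := a) refl (seq x n) ε ⟩
    seq x n                    ∎
  upper : ∀ n → N₂ ℕ.≤ n → N₃ ℕ.≤ n → seq x n ℚ.< ε
  upper n h₂ h₃ = begin-strict
    seq x n
      ≡⟨ ℚ.+-identityʳ (seq x n) ⟨
    seq x n ℚ.+ 0ℚ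
      <⟨ ℚ.+-monoʳ-< (seq x n) (q n h₂) ⟩
    seq x n ℚ.+ (seq y n ℚ.+ δ)
      ≡⟨ ℚ.+-assoc (seq x n) (seq y n) δ ⟨
    (seq x n ℚ.+ seq y n) ℚ.+ δ
      <⟨ ℚ.+-monoˡ-< δ (ℚ.≤-<-trans (p≤∣p∣ (seq x n ℚ.+ seq y n)) (∣x+y∣<δ n h₃)) ⟩
    δ ℚ.+ δ
      ≡⟨ δ+δ≡ε ⟩
    ε ∎
    where
    ∣x+y∣<δ : ∀ n → N₃ ℕ.≤ n → ℚ.∣ seq x n ℚ.+ seq y n ∣ ℚ.< δ
    ∣x+y∣<δ n h = subst (λ a → ℚ.∣ a ∣ ℚ.< δ) (p-0≡p (seq x n ℚ.+ seq y n)) (r n h)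

-- Late terms of `s` exceed a rational `η > 0`, so `η * ∣x∣` is at most `∣s * x∣` termwise.
-- Tolerance `η ℚ.* ε` for the product then gives `ε` for `x`, and no real has to be inverted.
*-cancelˡ-0 : ∀ {s x} → 0ℝ < s → s * x ≈ 0ℝ → x ≈ 0ℝ
*-cancelˡ-0 {s} {x} (η , 0<η , N₁ , η<s) s*x≈0 ε 0<ε
  with s*x≈0 (η ℚ.* ε) (ℚ.positive⁻¹ _ {{ℚ.pos*pos⇒pos η {{ℚ.positive 0<η}} ε {{ℚ.positive 0<ε}}}})
... | N₂ , p = N₁ ℕ.⊔ N₂ , λ n hn →
  subst (λ a → ℚ.∣ a ∣ ℚ.< ε) (sym (p-0≡p (seq x n)))
    (ℚ.*-cancelˡ-<-nonNeg η {{ℚ.nonNegative (ℚ.<⇒≤ 0<η)}}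
      (close n (ℕ.m⊔n≤o⇒m≤o N₁ N₂ hn) (ℕ.m⊔n≤o⇒n≤o N₁ N₂ hn)))
  where
  open ℚ.≤-Reasoning
  close : ∀ n → N₁ ℕ.≤ n → N₂ ℕ.≤ n → η ℚ.* ℚ.∣ seq x n ∣ ℚ.< η ℚ.* ε
  close n h₁ h₂ = begin-strict
    η ℚ.* ℚ.∣ seq x n ∣
      ≤⟨ ℚ.*-monoʳ-≤-nonNeg ℚ.∣ seq x n ∣ {{ℚ.∣-∣-nonNeg (seq x n)}}
           (ℚ.≤-trans (subst (ℚ._≤ seq s n) (ℚ.+-identityˡ η) (ℚ.<⇒≤ (η<s n h₁))) (p≤∣p∣ (seq s n))) ⟩
    ℚ.∣ seq s n ∣ ℚ.* ℚ.∣ seq x n ∣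
      ≡⟨ ℚ.∣p*q∣≡∣p∣*∣q∣ (seq s n) (seq x n) ⟨
    ℚ.∣ seq s n ℚ.* seq x n ∣
      ≡⟨ cong ℚ.∣_∣ (p-0≡p (seq s n ℚ.* seq x n)) ⟨
    ℚ.∣ seq s n ℚ.* seq x n ℚ.- 0ℚ ∣
      <⟨ p n h₂ ⟩
    η ℚ.* ε ∎

-- Finite sums of reals

∑-cong : ∀ {n} {f g : Vector ℝ n} → f ≋ g → ∑ f ≈ ∑ g
∑-cong {zero}  {f} {g} f≋g = ≈-refl {0ℝ}
∑-cong {suc n} {f} {g} f≋g =
  +-cong {f zero} {g zero} {∑ (f ∘ suc)} {∑ (g ∘ suc)} (f≋g zero) (∑-cong (f≋g ∘ suc))

∑-+ : ∀ {n} (f g : Vector ℝ n) → ∑ (λ i → f i + g i) ≈ ∑ f + ∑ g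
∑-+ {zero}  f g = pointwise {0ℝ} {0ℝ + 0ℝ} λ _ → refl
∑-+ {suc n} f g = begin
  f zero + g zero + ∑ (λ i → f (suc i) + g (suc i))
    ≈⟨ +-cong {f zero + g zero} {f zero + g zero}
         {∑ (λ i → f (suc i) + g (suc i))} {∑ (f ∘ suc) + ∑ (g ∘ suc)}
         (≈-refl {f zero + g zero}) (∑-+ (f ∘ suc) (g ∘ suc)) ⟩
  f zero + g zero + (∑ (f ∘ suc) + ∑ (g ∘ suc))
    ≈⟨ pointwise {f zero + g zero + (∑ (f ∘ suc) + ∑ (g ∘ suc))} {∑ f + ∑ g} (λ n →
         solve 4 (λ a b c d → a :+ b :+ (c :+ d) := (a :+ c) :+ (b :+ d)) refl
           (seq (f zero) n) (seq (g zero) n) (seq (∑ (f ∘ suc)) n) (seq (∑ (g ∘ suc)) n)) ⟩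
  ∑ f + ∑ g ∎
  where open SetoidReasoning ℝ-setoid

∑-nonneg : ∀ {n} {f : Vector ℝ n} → (∀ i → 0ℝ ≤ᴿ f i) → 0ℝ ≤ᴿ ∑ f
∑-nonneg {zero}  0≤f = 0≤-fromℚ {0ℚ} ℚ.≤-refl
∑-nonneg {suc n} {f} 0≤f = 0≤-+ {f zero} {∑ (f ∘ suc)} (0≤f zero) (∑-nonneg (0≤f ∘ suc))

∑-zero : ∀ {n} {f : Vector ℝ n} → (∀ i → f i ≈ 0ℝ) → ∑ f ≈ 0ℝ
∑-zero {zero}  f≈0 = ≈-refl {0ℝ}
∑-zero {suc n} {f} f≈0 = ≈-trans {∑ f} {0ℝ + 0ℝ} {0ℝ}
  (+-cong {f zero} {0ℝ} {∑ (f ∘ suc)} {0ℝ} (f≈0 zero) (∑-zero (f≈0 ∘ suc)))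
  (pointwise {0ℝ + 0ℝ} {0ℝ} λ _ → refl)

-- Sign and pair equations on base polytopes

basePolytope-nonneg : ∀ {n} (M : Matroid n) {y} → BasePolytope M y → ∀ e → 0ℝ ≤ᴿ y e
basePolytope-nonneg M {y} (k , c , v , 0≤c , _ , v-basis , y≋) e =
  0≤-resp {∑ λ i → c i * v i e} {y e} (≈-sym {y e} {∑ λ i → c i * v i e} (y≋ e))
    (∑-nonneg {f = λ i → c i * v i e} λ i → term i (v-basis i))
  where
  0≤c*if : ∀ i b → 0ℝ ≤ᴿ c i * (if b then 1ℝ else 0ℝ)
  0≤c*if i true = 0≤-resp {c i} {c i * 1ℝ}
    (pointwise {c i} {c i * 1ℝ} λ n → sym (ℚ.*-identityʳ (seq (c i) n))) (0≤c i)
  0≤c*if i false = 0≤-resp {0ℝ} {c i * 0ℝ}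
    (pointwise {0ℝ} {c i * 0ℝ} λ n → sym (ℚ.*-zeroʳ (seq (c i) n))) (0≤-fromℚ {0ℚ} ℚ.≤-refl)

  term : ∀ i → ∃[ B ] (IsBasis M B × v i ≋ χ B) → 0ℝ ≤ᴿ c i * v i e
  term i (B , _ , v≋χ) = 0≤-resp {c i * χ B e} {c i * v i e}
    (*-congˡ (c i) {χ B e} {v i e} (≈-sym {v i e} {χ B e} (v≋χ e))) (0≤c*if i (lookup B e))

-- Every basis contains exactly one of the two elements, so the summands at `e` and `f` merge into
-- the bare coefficient `c i`, and the coefficients sum to 1.
basePolytope-complement : ∀ {n} (M : Matroid n) {y} → BasePolytope M y → ∀ {e f} →
  (∀ {B} → IsBasis M B → lookup B e ≡ not (lookup B f)) → y e + y f ≈ 1ℝ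
basePolytope-complement M {y} (k , c , v , _ , ∑c≈1 , v-basis , y≋) {e} {f} complement = begin
  y e + y f
    ≈⟨ +-cong {y e} {∑ λ i → c i * v i e} {y f} {∑ λ i → c i * v i f} (y≋ e) (y≋ f) ⟩
  ∑ (λ i → c i * v i e) + ∑ (λ i → c i * v i f)
    ≈⟨ ∑-+ (λ i → c i * v i e) (λ i → c i * v i f) ⟨
  ∑ (λ i → c i * v i e + c i * v i f)
    ≈⟨ ∑-cong (λ i → term i (v-basis i)) ⟩
  ∑ c
    ≈⟨ ∑c≈1 ⟩
  1ℝ ∎
  where
  open SetoidReasoning ℝ-setoid
  collapse : ∀ i {a b} → a ≡ not b → c i * (if a then 1ℝ else 0ℝ) + c i * (if b then 1ℝ else 0ℝ) ≈ c i
  collapse i {b = true} refl = pointwise {c i * 0ℝ + c i * 1ℝ} {c i} λ n →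
    trans (cong₂ ℚ._+_ (ℚ.*-zeroʳ (seq (c i) n)) (ℚ.*-identityʳ (seq (c i) n)))
      (ℚ.+-identityˡ (seq (c i) n))
  collapse i {b = false} refl = pointwise {c i * 1ℝ + c i * 0ℝ} {c i} λ n →
    trans (cong₂ ℚ._+_ (ℚ.*-identityʳ (seq (c i) n)) (ℚ.*-zeroʳ (seq (c i) n)))
      (ℚ.+-identityʳ (seq (c i) n))

  term : ∀ i → ∃[ B ] (IsBasis M B × v i ≋ χ B) → c i * v i e + c i * v i f ≈ c i
  term i (B , basis , v≋χ) = begin
    c i * v i e + c i * v i f
      ≈⟨ +-cong {c i * v i e} {c i * χ B e} {c i * v i f} {c i * χ B f}
           (*-congˡ (c i) {v i e} {χ B e} (v≋χ e)) (*-congˡ (c i) {v i f} {χ B f} (v≋χ f)) ⟩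
    c i * χ B e + c i * χ B f
      ≈⟨ collapse i (complement basis) ⟩
    c i ∎

-- Solving linear equations over the reals

x<y⇒0<y-x : ∀ {x y} → x < y → 0ℝ < y - x
x<y⇒0<y-x {x} {y} (η , 0<η , N , x+η<y) = η , 0<η , N , λ n N≤n →
  subst (ℚ._< seq y n ℚ.- seq x n)
    (trans (solve 2 (λ x η → (x :+ η) :- x := η) refl (seq x n) η) (sym (ℚ.+-identityˡ η)))
    (ℚ.+-monoˡ-< (ℚ.- seq x n) (x+η<y n N≤n))

+-cancelˡ : ∀ u {v v′ r} → u + v ≈ r → u + v′ ≈ r → v ≈ v′
+-cancelˡ u {v} {v′} {r} u+v≈r u+v′≈r = begin
  v              ≈⟨ undo v ⟨
  u + v + - u    ≈⟨ +-cong {u + v} {u + v′} { - u} { - u} u+v≈u+v′ (≈-refl { - u}) ⟩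
  u + v′ + - u   ≈⟨ undo v′ ⟩
  v′             ∎
  where
  open SetoidReasoning ℝ-setoid
  u+v≈u+v′ : u + v ≈ u + v′
  u+v≈u+v′ = ≈-trans {u + v} {r} {u + v′} u+v≈r (≈-sym {u + v′} {r} u+v′≈r)
  undo : ∀ v → u + v + - u ≈ v
  undo v = pointwise {u + v + - u} {v} λ n →
    solve 2 (λ u v → (u :+ v) :- u := v) refl (seq u n) (seq v n)

complement-value : ∀ u v {p q} → u + v ≈ 1ℝ → v ≈ fromℚ q → q ℚ.+ p ≡ 1ℚ → u ≈ fromℚ p
complement-value u v {p} {q} u+v≈1 v≈q q+p≡1 = +-cancelˡ v {u} {fromℚ p} {1ℝ} v+u≈1 v+p≈1
  where
  open SetoidReasoning ℝ-setoid
  v+u≈1 : v + u ≈ 1ℝ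
  v+u≈1 = begin
    v + u   ≈⟨ pointwise {v + u} {u + v} (λ n → ℚ.+-comm (seq v n) (seq u n)) ⟩
    u + v   ≈⟨ u+v≈1 ⟩
    1ℝ      ∎
  v+p≈1 : v + fromℚ p ≈ 1ℝ
  v+p≈1 = begin
    v + fromℚ p         ≈⟨ +-cong {v} {fromℚ q} {fromℚ p} {fromℚ p} v≈q (≈-refl {fromℚ p}) ⟩
    fromℚ q + fromℚ p   ≈⟨ pointwise {fromℚ q + fromℚ p} {1ℝ} (λ _ → q+p≡1) ⟩
    1ℝ                  ∎

x+x≈1⇒x≈½ : ∀ x → x + x ≈ 1ℝ → x ≈ fromℚ ½
x+x≈1⇒x≈½ x x+x≈1 = begin
  x                    ≈⟨ pointwise {fromℚ ½ * (x + x)} {x} (λ n → half-double (seq x n)) ⟨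
  fromℚ ½ * (x + x)    ≈⟨ *-congˡ (fromℚ ½) {x + x} {1ℝ} x+x≈1 ⟩
  fromℚ ½ * 1ℝ         ≈⟨ pointwise {fromℚ ½ * 1ℝ} {fromℚ ½} (λ _ → refl) ⟩
  fromℚ ½              ∎
  where
  open SetoidReasoning ℝ-setoid
  half-double : ∀ a → ½ ℚ.* (a ℚ.+ a) ≡ a
  half-double a = trans (ℚ.*-distribˡ-+ ½ a a) (trans (sym (ℚ.*-distribʳ-+ a ½ ½)) (ℚ.*-identityˡ a))

-- `_/_` cancels a gcd and does not evaluate on variable numerators, so the identity is checked on
-- unnormalised fractions with denominator 1.
/1-homo-+ : ∀ a b → + (a ℕ.+ b) / 1 ≡ + a / 1 ℚ.+ + b / 1
/1-homo-+ a b = ℚ.toℚᵘ-injective (begin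
  ℚ.toℚᵘ (+ (a ℕ.+ b) / 1)
    ≈⟨ ℚ.toℚᵘ-fromℚᵘ (ℚᵘ.mkℚᵘ (+ (a ℕ.+ b)) 0) ⟩
  ℚᵘ.mkℚᵘ (+ (a ℕ.+ b)) 0
    ≈⟨ ℚᵘ.*≡* (cong (ℤ._* + 1) (sym (cong₂ ℤ._+_ (ℤ.*-identityʳ (+ a)) (ℤ.*-identityʳ (+ b))))) ⟩
  ℚᵘ.mkℚᵘ (+ a) 0 ℚᵘ.+ ℚᵘ.mkℚᵘ (+ b) 0
    ≈⟨ ℚᵘ.+-cong (ℚ.toℚᵘ-fromℚᵘ (ℚᵘ.mkℚᵘ (+ a) 0)) (ℚ.toℚᵘ-fromℚᵘ (ℚᵘ.mkℚᵘ (+ b) 0)) ⟨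
  ℚ.toℚᵘ (+ a / 1) ℚᵘ.+ ℚ.toℚᵘ (+ b / 1)
    ≈⟨ ℚ.toℚᵘ-homo-+ (+ a / 1) (+ b / 1) ⟨
  ℚ.toℚᵘ (+ a / 1 ℚ.+ + b / 1) ∎)
  where open SetoidReasoning ℚᵘ.≃-setoid

-- Partition matroids

∣p∣≤1+∣p-x∣ : ∀ {n} (p : Subset n) x → ∣ p ∣ ℕ.≤ suc ∣ p ∖ x ∣
∣p∣≤1+∣p-x∣ (inside  ∷ p) zero    = s≤s (ℕ.≤-reflexive (cong ∣_∣ (sym (p─⊥≡p p))))
∣p∣≤1+∣p-x∣ (outside ∷ p) zero    = ℕ.m≤n⇒m≤1+n (ℕ.≤-reflexive (cong ∣_∣ (sym (p─⊥≡p p))))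
∣p∣≤1+∣p-x∣ (inside  ∷ p) (suc x) = s≤s (∣p∣≤1+∣p-x∣ p x)
∣p∣≤1+∣p-x∣ (outside ∷ p) (suc x) = ∣p∣≤1+∣p-x∣ p x

x∉p-x : ∀ {n} x (p : Subset n) → x ∉ p ∖ x
x∉p-x zero    (_ ∷ p) ()
x∉p-x (suc x) (_ ∷ p) (there x∈p-x) = x∉p-x x p x∈p-x

module _ {n} {K : Set} (κ : Fin n → K) where

  -- The independent sets of the partition matroid whose blocks are the fibres of `κ`, each of
  -- capacity one.
  PartialTransversal : Subset n → Set
  PartialTransversal S = ∀ {e f} → e ∈ S → f ∈ S → κ e ≡ κ f → e ≡ f

  Meets : Subset n → Fin n → Set
  Meets S e = ∃[ f ] (f ∈ S × κ f ≡ κ e)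

  -- Sending each element of `B` to one of `A` with the same label is injective, because labels
  -- separate `B`. The induction removes such a pair from the two sets.
  ∣∣-mono : ∀ {A B} → PartialTransversal B → (∀ {e} → e ∈ B → Meets A e) → ∣ B ∣ ℕ.≤ ∣ A ∣
  ∣∣-mono {A} {B} = go A (⊂-wellFounded B)
    where
    go : ∀ A {B} → Acc _⊂_ B → PartialTransversal B →
         (∀ {e} → e ∈ B → Meets A e) → ∣ B ∣ ℕ.≤ ∣ A ∣
    go A {B} (acc rec) inj meets with nonempty? B
    ... | no  empty rewrite Empty-unique empty | ∣⊥∣≡0 n = z≤n
    ... | yes (e , e∈B) with meets e∈B
    ... | f , f∈A , κf≡κe = begin
      ∣ B ∣             ≤⟨ ∣p∣≤1+∣p-x∣ B e ⟩
      suc ∣ B ∖ e ∣     ≤⟨ s≤s (go (A ∖ f) (rec (x∈p⇒p-x⊂p e∈B))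
                             (λ x∈ y∈ → inj (B∖e⊆B x∈) (B∖e⊆B y∈)) meets′) ⟩
      suc ∣ A ∖ f ∣     ≤⟨ x∈p⇒∣p-x∣<∣p∣ f∈A ⟩
      ∣ A ∣             ∎
      where
      open ℕ.≤-Reasoning
      B∖e⊆B : B ∖ e ⊆ B
      B∖e⊆B = p─q⊆p B ⁅ e ⁆
      meets′ : ∀ {g} → g ∈ B ∖ e → Meets (A ∖ f) g
      meets′ {g} g∈B∖e with meets (B∖e⊆B g∈B∖e)
      ... | h , h∈A , κh≡κg = h , x∈p∧x≢y⇒x∈p-y h∈A h≢f , κh≡κg
        where
        -- If `h` were the removed `f`, then `g` would share its label with `e` and so equal `e`,
        -- although `g` survives the removal of `e`.
        h≢f : h ≢ f
        h≢f refl with inj (B∖e⊆B g∈B∖e) e∈B (trans (sym κh≡κg) κf≡κe)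
        ... | refl = x∉p-x e B g∈B∖e

  extend : ∀ {A e} → PartialTransversal A → ¬ Meets A e → PartialTransversal (A ∪ ⁅ e ⁆)
  extend {A} {e} inj misses {f} {g} f∈ g∈ κf≡κg with x∈p∪q⁻ A ⁅ e ⁆ f∈ | x∈p∪q⁻ A ⁅ e ⁆ g∈
  ... | inj₁ f∈A | inj₁ g∈A = inj f∈A g∈A κf≡κg
  ... | inj₁ f∈A | inj₂ g∈e = contradiction (f , f∈A , trans κf≡κg (cong κ (x∈⁅y⁆⇒x≡y e g∈e))) misses
  ... | inj₂ f∈e | inj₁ g∈A = contradiction (g , g∈A , trans (sym κf≡κg) (cong κ (x∈⁅y⁆⇒x≡y e f∈e))) misses
  ... | inj₂ f∈e | inj₂ g∈e = trans (x∈⁅y⁆⇒x≡y e f∈e) (sym (x∈⁅y⁆⇒x≡y e g∈e))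

  module _ (_≟_ : DecidableEquality K) where

    meets? : ∀ S e → Dec (Meets S e)
    meets? S e = any? (λ f → (f ∈? S) ×-dec (κ f ≟ κ e))

    partitionMatroid : Matroid n
    partitionMatroid = record
      { Indep    = PartialTransversal
      ; ∅-indep  = λ e∈∅ → contradiction e∈∅ ∉⊥
      ; ⊆-closed = λ A⊆B inj e∈A f∈A → inj (A⊆B e∈A) (A⊆B f∈A)
      ; augment  = augment
      }
      where
      augment : ∀ {A B} → PartialTransversal A → PartialTransversal B → ∣ A ∣ ℕ.< ∣ B ∣ →
                ∃[ e ] (e ∈ B × e ∉ A × PartialTransversal (A ∪ ⁅ e ⁆))
      augment {A} {B} injA injB ∣A∣<∣B∣
        -- If every label of `B` occurred in `A`, `∣∣-mono` would contradict the sizes. So some `e`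
        -- in `B` has a new label, and adjoining it preserves independence.
        with any? (λ e → (e ∈? B) ×-dec (¬? (meets? A e)))
      ... | yes (e , e∈B , misses) = e , e∈B , (λ e∈A → misses (e , e∈A , refl)) , extend injA misses
      ... | no  none = contradiction (∣∣-mono injB meets) (ℕ.<⇒≱ ∣A∣<∣B∣)
        where
        meets : ∀ {e} → e ∈ B → Meets A e
        meets {e} e∈B with meets? A e
        ... | yes m = m
        ... | no ¬m = contradiction (e , e∈B , ¬m) none

    -- Were the label of `e` missed, `B ∪ ⁅ e ⁆` would be independent and by maximality equal to
    -- `B`, so `e` itself would lie in `B` and meet the label.
    basis-meets : ∀ {B} → IsBasis partitionMatroid B → ∀ e → Meets B e
    basis-meets {B} (inj , maximal) e with meets? B e
    ... | yes m = m
    ... | no ¬m = contradiction (e , subst (e ∈_) B∪e≡B (q⊆p∪q B ⁅ e ⁆ (x∈⁅x⁆ e)) , refl) ¬m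
      where
      B∪e≡B : B ∪ ⁅ e ⁆ ≡ B
      B∪e≡B = maximal (extend inj ¬m) (p⊆p∪q ⁅ e ⁆)

    -- An element of a larger independent set shares its label with an element of `B`, and
    -- independence of the larger set identifies the two.
    transversal⇒basis : ∀ {B} → PartialTransversal B → (∀ e → Meets B e) → IsBasis partitionMatroid B
    transversal⇒basis {B} inj meets = inj , λ {C} injC B⊆C → ⊆-antisym (C⊆B injC B⊆C) B⊆C
      where
      C⊆B : ∀ {C} → PartialTransversal C → B ⊆ C → C ⊆ B
      C⊆B injC B⊆C {e} e∈C with meets e
      ... | f , f∈B , κf≡κe = subst (_∈ B) (injC (B⊆C f∈B) e∈C κf≡κe) f∈B

    -- In a block of two, independence forbids taking both elements and `basis-meets` forbids taking
    -- neither.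
    basis-complement : ∀ {B e f} → IsBasis partitionMatroid B → e ≢ f → κ e ≡ κ f →
      (∀ g → κ g ≡ κ e → g ≡ e ⊎ g ≡ f) → lookup B e ≡ not (lookup B f)
    basis-complement {B} {e} {f} basis@(inj , _) e≢f κe≡κf class
      with lookup B e in e∈?B | lookup B f in f∈?B
    ... | true  | true  = contradiction (inj (lookup⇒[]= e B e∈?B) (lookup⇒[]= f B f∈?B) κe≡κf) e≢f
    ... | true  | false = refl
    ... | false | true  = refl
    ... | false | false with basis-meets basis e
    ... | g , g∈B , κg≡κe with class g κg≡κe
    ... | inj₁ refl = contradiction (trans (sym ([]=⇒lookup g∈B)) e∈?B) λ()
    ... | inj₂ refl = contradiction (trans (sym ([]=⇒lookup g∈B)) f∈?B) λ()

-- The two cycles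

-- The element s_i of the ground set is combine i s.
pattern X = zero
pattern Y = suc zero
pattern Z = suc (suc zero)
pattern W = suc (suc (suc zero))

half : Fin 4 → Fin 2
half X = zero
half Y = zero
half Z = suc zero
half W = suc zero

mate : Fin 4 → Fin 4
mate X = Y
mate Y = X
mate Z = W
mate W = Z

half-mate : ∀ s → half s ≡ half (mate s)
half-mate X = refl
half-mate Y = refl
half-mate Z = refl
half-mate W = refl

s≢mate : ∀ s → s ≢ mate s
s≢mate X ()
s≢mate Y ()
s≢mate Z ()
s≢mate W ()

same-half : ∀ s t → half t ≡ half s → t ≡ s ⊎ t ≡ mate s
same-half X X _ = inj₁ refl
same-half X Y _ = inj₂ refl
same-half X Z ()
same-half X W ()
same-half Y X _ = inj₂ refl
same-half Y Y _ = inj₁ refl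
same-half Y Z ()
same-half Y W ()
same-half Z Z _ = inj₁ refl
same-half Z W _ = inj₂ refl
same-half W Z _ = inj₂ refl
same-half W W _ = inj₁ refl

chosen : Bool → Bool → Fin 4 → Bool
chosen a b X = a
chosen a b Y = not a
chosen a b Z = b
chosen a b W = not b

chosen-mate : ∀ a b s → chosen a b (mate s) ≡ not (chosen a b s)
chosen-mate a b X = refl
chosen-mate a b Y = sym (not-involutive a)
chosen-mate a b Z = refl
chosen-mate a b W = sym (not-involutive b)

-- These are the four common bases: `a` selects X rather than Y, `b` selects Z rather than W. Thus X
-- ∪ W is `pick m true false`.
pick : ∀ m → Bool → Bool → Subset (m ℕ.* 4)
pick m a b = tabulate (chosen a b ∘ remainder {m} 4)

cyclicPred : ∀ {m} → Fin m → Fin m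
cyclicPred {suc m} zero    = Fin.fromℕ m
cyclicPred         (suc i) = inject₁ i

cyclicPred-injective : ∀ {m} → Injective _≡_ _≡_ (cyclicPred {m})
cyclicPred-injective {x = zero}  {zero}  _  = refl
cyclicPred-injective {x = zero}  {suc j} eq = contradiction eq fromℕ≢inject₁
cyclicPred-injective {x = suc i} {zero}  eq = contradiction (sym eq) fromℕ≢inject₁
cyclicPred-injective {x = suc i} {suc j} eq = cong suc (inject₁-injective eq)

cyclicPred-surjective : ∀ {m} → StrictlySurjective _≡_ (cyclicPred {m})
cyclicPred-surjective i with view i
... | ‵fromℕ     = zero , refl
... | ‵inject₁ j = suc j , refl

-- X_i and Y_j form a pair when π X i ≡ π Y j, and likewise Z_i and W_j.
module _ {m : ℕ} (π : Fin 4 → Fin m → Fin m)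
         (π-injective : ∀ s → Injective _≡_ _≡_ (π s)) where

  label : Fin (m ℕ.* 4) → Fin m × Fin 2
  label e = π (remainder {m} 4 e) (quotient 4 e) , half (remainder {m} 4 e)

  label-combine : ∀ i s → label (combine i s) ≡ (π s i , half s)
  label-combine i s = cong (λ (j , t) → π t j , half t) (remQuot-combine i s)

  pairing : Matroid (m ℕ.* 4)
  pairing = partitionMatroid label (Product.≡-dec Fin._≟_ Fin._≟_)

  -- Injectivity of `π s` and `π (mate s)` leaves only these two elements in their block, so
  -- `basis-complement` applies.
  basis-mate : ∀ {B} → IsBasis pairing B → ∀ s {i j} → π s i ≡ π (mate s) j →
    lookup B (combine i s) ≡ not (lookup B (combine j (mate s)))
  basis-mate basis s {i} {j} eq =
    basis-complement label (Product.≡-dec Fin._≟_ Fin._≟_) basis distinct same class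
    where
    distinct : combine i s ≢ combine j (mate s)
    distinct e≡f = s≢mate s (cong proj₂
      (trans (sym (remQuot-combine i s)) (trans (cong (remQuot 4) e≡f) (remQuot-combine j (mate s)))))

    same : label (combine i s) ≡ label (combine j (mate s))
    same = trans (label-combine i s) (trans (cong₂ _,_ eq (half-mate s))
      (sym (label-combine j (mate s))))

    class : ∀ g → label g ≡ label (combine i s) → g ≡ combine i s ⊎ g ≡ combine j (mate s)
    class g label≡ with combine-surjective {m} {4} g
    ... | l , t , refl with Product.,-injective
                              (trans (sym (label-combine l t)) (trans label≡ (label-combine i s)))
    ... | πtl≡πsi , half≡ with same-half s t half≡
    ... | inj₁ refl = inj₁ (cong (λ k → combine k s) (π-injective s πtl≡πsi))
    ... | inj₂ refl = inj₂ (cong (λ k → combine k (mate s)) (π-injective (mate s) (trans πtl≡πsi eq)))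

  -- Of two mates exactly one is chosen, so chosen elements with equal labels have the same type and
  -- injectivity identifies them. For an element whose type is not chosen, surjectivity supplies a
  -- chosen mate with its label.
  pick-basis : (∀ s → StrictlySurjective _≡_ (π s)) → ∀ a b → IsBasis pairing (pick m a b)
  pick-basis π-surjective a b = transversal⇒basis label (Product.≡-dec Fin._≟_ Fin._≟_) separated meets
    where
    e∈⇒chosen : ∀ {e} → e ∈ pick m a b → chosen a b (remainder {m} 4 e) ≡ true
    e∈⇒chosen {e} e∈ = trans (sym (lookup∘tabulate _ e)) ([]=⇒lookup e∈)

    combine∈ : ∀ i {s} → chosen a b s ≡ true → combine i s ∈ pick m a b
    combine∈ i {s} c = lookup⇒[]= _ _
      (trans (lookup∘tabulate _ (combine i s))
        (trans (cong (chosen a b ∘ proj₂) (remQuot-combine i s)) c))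

    separated : PartialTransversal label (pick m a b)
    separated {e} {f} e∈ f∈ label≡ with Product.,-injective label≡
    ... | π≡ , half≡ with same-half (remainder {m} 4 f) (remainder {m} 4 e) half≡
    ... | inj₁ t≡s = trans (sym (combine-remQuot {m} 4 e))
            (trans (cong₂ combine (π-injective _ (trans (cong (λ t → π t _) (sym t≡s)) π≡)) t≡s)
              (combine-remQuot {m} 4 f))
    ... | inj₂ t≡mate = contradiction true≡false λ()
      where
      open ≡-Reasoning
      true≡false : true ≡ false
      true≡false = begin
        true                                      ≡⟨ e∈⇒chosen e∈ ⟨
        chosen a b (remainder {m} 4 e)            ≡⟨ cong (chosen a b) t≡mate ⟩
        chosen a b (mate (remainder {m} 4 f))     ≡⟨ chosen-mate a b (remainder {m} 4 f) ⟩
        not (chosen a b (remainder {m} 4 f))      ≡⟨ cong not (e∈⇒chosen f∈) ⟩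
        false                                     ∎

    meets : ∀ e → Meets label (pick m a b) e
    meets e with combine-surjective {m} {4} e
    ... | i , s , refl with chosen a b s in c
    ... | true  = combine i s , combine∈ i c , refl
    ... | false with π-surjective (mate s) (π s i)
    ... | j , πj≡ = combine j (mate s) ,
      combine∈ j (trans (chosen-mate a b s) (cong not c)) ,
      trans (label-combine j (mate s))
        (trans (cong₂ _,_ πj≡ (sym (half-mate s))) (sym (label-combine i s)))

-- X_{i-1} and Y_i both receive the index i-1, which produces the pairs of the second matroid; using
-- `id` for all types produces those of the first.
shift : ∀ {m} → Fin 4 → Fin m → Fin m
shift X = id
shift Y = cyclicPred
shift Z = id
shift W = cyclicPred

shift-injective : ∀ {m} s → Injective _≡_ _≡_ (shift {m} s)
shift-injective X = id
shift-injective Y = cyclicPred-injective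
shift-injective Z = id
shift-injective W = cyclicPred-injective

shift-surjective : ∀ {m} s → StrictlySurjective _≡_ (shift {m} s)
shift-surjective X i = i , refl
shift-surjective Y = cyclicPred-surjective
shift-surjective Z i = i , refl
shift-surjective W = cyclicPred-surjective

straight twisted : ∀ m → Matroid (m ℕ.* 4)
straight m = pairing {m} (λ _ → id) (λ _ → id)
twisted  m = pairing {m} shift shift-injective

pick-straight : ∀ m a b → IsBasis (straight m) (pick m a b)
pick-straight m = pick-basis (λ _ → id) (λ _ → id) (λ _ i → i , refl)

pick-twisted : ∀ m a b → IsBasis (twisted m) (pick m a b)
pick-twisted m = pick-basis shift shift-injective shift-surjective

-- X_{i+1} and X_i are both opposite to Y_{i+1}, the one by the first matroid and the other by the
-- second. So membership is constant along X, likewise along Z, and the first matroid settles Y and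
-- W.
commonBasis⇒pick : ∀ m {B} → IsCommonBasis (straight (suc m)) (twisted (suc m)) B →
  B ≡ pick (suc m) (lookup B (combine {suc m} zero X)) (lookup B (combine {suc m} zero Z))
commonBasis⇒pick m {B} (basis , basis′) = trans (sym (tabulate∘lookup B)) (tabulate-cong agree)
  where
  _at_ : Fin (suc m) → Fin 4 → Bool
  i at s = lookup B (combine i s)

  straight-mate : ∀ s i → i at s ≡ not (i at mate s)
  straight-mate s i = basis-mate (λ _ → id) (λ _ → id) basis s {i} {i} refl

  constant : ∀ s → (∀ i → inject₁ i at s ≡ not (suc i at mate s)) → ∀ i → i at s ≡ zero at s
  constant s twisted-mate = <-weakInduction _ refl λ i ih →
    trans (straight-mate s (suc i)) (trans (sym (twisted-mate i)) ih)

  X-constant : ∀ i → i at X ≡ zero at X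
  -- The `refl` proves `inject₁ i ≡ cyclicPred (suc i)`: the twisted pair joins X_i with Y_{i+1}.
  X-constant = constant X (λ i → basis-mate shift shift-injective basis′ X {inject₁ i} {suc i} refl)

  Z-constant : ∀ i → i at Z ≡ zero at Z
  Z-constant = constant Z (λ i → basis-mate shift shift-injective basis′ Z {inject₁ i} {suc i} refl)

  agree-combine : ∀ i s → i at s ≡ chosen (zero at X) (zero at Z) s
  agree-combine i X = X-constant i
  agree-combine i Y = trans (straight-mate Y i) (cong not (X-constant i))
  agree-combine i Z = Z-constant i
  agree-combine i W = trans (straight-mate W i) (cong not (Z-constant i))

  agree : ∀ e → lookup B e ≡ chosen (zero at X) (zero at Z) (remainder {suc m} 4 e)
  agree e = trans (cong (lookup B) (sym (combine-remQuot {suc m} 4 e)))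
    (agree-combine (quotient 4 e) (remainder {suc m} 4 e))

-- The weight function

-- The element s_i has number 4i + s, so as element numbers `Y` and `W` denote Y_0 and W_0, and four
-- successors of `Y` give Y_1. The size `2 ℕ.+ k` guarantees that block 1 exists.
heavy : ∀ k → Weight ((2 ℕ.+ k) ℕ.* 4)
heavy k Y = suc zero
heavy k W = suc zero
heavy k (suc (suc (suc (suc Y)))) = suc zero
heavy k _ = zero

foldr-zero : ∀ {n} (f : Vector ℕ n) → (∀ e → f e ≡ 0) → foldr ℕ._+_ 0 f ≡ 0
foldr-zero {zero}  f f≡0 = refl
foldr-zero {suc n} f f≡0 = cong₂ ℕ._+_ (f≡0 zero) (foldr-zero (f ∘ suc) (f≡0 ∘ suc))

-- The eight elements of the first two blocks evaluate once `a` and `b` are constructors; beyond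
-- them `heavy` is zero, so the tail of the sum vanishes.
weight-pick : ∀ k a b →
  weight (heavy k) (pick (2 ℕ.+ k) a b) ≡ (if a then 0 else 2) ℕ.+ (if b then 0 else 1)
weight-pick k a b = split a b (foldr-zero _ λ e → if-eta (lookup (pick (2 ℕ.+ k) a b) (8 ↑ʳ e)))
  where
  split : ∀ a b →
    foldr ℕ._+_ 0 (λ e →
      if lookup (pick (2 ℕ.+ k) a b) (8 ↑ʳ e) then toℕ (heavy k (8 ↑ʳ e)) else 0) ≡ 0 →
    weight (heavy k) (pick (2 ℕ.+ k) a b) ≡ (if a then 0 else 2) ℕ.+ (if b then 0 else 1)
  split true  true  = id
  split true  false = cong (1 ℕ.+_)
  split false true  = cong (2 ℕ.+_)
  split false false = cong (3 ℕ.+_)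

-- Eight uses of `skip` or `take` strip the first two blocks and keep Y_0, W_0 and Y_1; all later
-- coefficients are zero.
heavy-sum : ∀ k (y : Vector ℝ ((2 ℕ.+ k) ℕ.* 4)) →
  heavy k ᵀ y ≈ y Y + (y W + y (combine {2 ℕ.+ k} {4} (suc zero) Y))
heavy-sum k y = begin
  heavy k ᵀ y
    ≈⟨ pointwise {heavy k ᵀ y} {S + rest} regroup ⟩
  S + rest
    ≈⟨ +-cong {S} {S} {rest} {0ℝ} (≈-refl {S})
         (∑-zero λ e → pointwise {0ℝ * y (8 ↑ʳ e)} {0ℝ} λ n → ℚ.*-zeroˡ (seq (y (8 ↑ʳ e)) n)) ⟩
  S + 0ℝ
    ≈⟨ pointwise {S + 0ℝ} {S} (λ n → ℚ.+-identityʳ (seq S n)) ⟩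
  S ∎
  where
  open SetoidReasoning ℝ-setoid
  y₁ : Fin 4 → ℝ
  y₁ s = y (combine {2 ℕ.+ k} {4} (suc zero) s)
  S rest : ℝ
  S    = y Y + (y W + y₁ Y)
  rest = ∑ λ e → 0ℝ * y (8 ↑ʳ e)
  skip : ∀ a {s s′} → s ≡ s′ → 0ℚ ℚ.* a ℚ.+ s ≡ s′
  skip a {s} s≡s′ = trans (cong (ℚ._+ s) (ℚ.*-zeroˡ a)) (trans (ℚ.+-identityˡ s) s≡s′)
  take : ∀ a {s s′} → s ≡ s′ → 1ℚ ℚ.* a ℚ.+ s ≡ a ℚ.+ s′
  take a s≡s′ = cong₂ ℚ._+_ (ℚ.*-identityˡ a) s≡s′
  regroup : ∀ n → seq (heavy k ᵀ y) n ≡ seq (S + rest) n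
  regroup n = trans
    (skip (seq (y X) n) (take (seq (y Y) n) (skip (seq (y Z) n) (take (seq (y W) n)
      (skip (seq (y₁ X) n) (take (seq (y₁ Y) n) (skip (seq (y₁ Z) n) (skip (seq (y₁ W) n) refl))))))))
    (solve 4 (λ a b c d → a :+ (b :+ (c :+ d)) := a :+ (b :+ c) :+ d) refl
      (seq (y Y) n) (seq (y W) n) (seq (y₁ Y) n) (seq rest n))

-- The fractional point

fractional : Fin 4 → ℚ
fractional X = ½
fractional Y = ½
fractional Z = 1ℚ
fractional W = 0ℚ

fractionalPoint : ∀ m → Vector ℝ (m ℕ.* 4)
fractionalPoint m e = fromℚ (fractional (remainder {m} 4 e))

χ-pick : ∀ m a b e → χ (pick m a b) e ≡ (if chosen a b (remainder {m} 4 e) then 1ℝ else 0ℝ)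
χ-pick m a b e = cong (λ c → if c then 1ℝ else 0ℝ) (lookup∘tabulate (chosen a b ∘ remainder {m} 4) e)

-- The point is the midpoint of X ∪ Z and Y ∪ Z. The matroid is left general so that the same convex
-- combination serves both base polytopes.
fractional∈ : ∀ m (M : Matroid (m ℕ.* 4)) → (∀ a b → IsBasis M (pick m a b)) →
  BasePolytope M (fractionalPoint m)
fractional∈ m M bases = 2 , (λ _ → fromℚ ½) , v , (λ _ → 0≤-fromℚ {½} (ℚ.nonNegative⁻¹ ½)) ,
  pointwise {fromℚ ½ + (fromℚ ½ + 0ℝ)} {1ℝ} (λ _ → refl) , v-basis , midpoint
  where
  v : Vector (Vector ℝ (m ℕ.* 4)) 2
  v zero       = χ (pick m true true)
  v (suc zero) = χ (pick m false true)
  v-basis : ∀ i → ∃[ B ] (IsBasis M B × v i ≋ χ B)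
  v-basis zero       = pick m true true , bases true true , λ e → ≈-refl {v zero e}
  v-basis (suc zero) = pick m false true , bases false true , λ e → ≈-refl {v (suc zero) e}
  indicator : Bool → Bool → Fin 4 → ℝ
  indicator a b s = if chosen a b s then 1ℝ else 0ℝ
  average : ∀ s n → fractional s ≡
    ½ ℚ.* seq (indicator true true s) n ℚ.+ (½ ℚ.* seq (indicator false true s) n ℚ.+ 0ℚ)
  average X n = refl
  average Y n = refl
  average Z n = refl
  average W n = refl
  midpoint : fractionalPoint m ≋ (λ e → ∑ λ i → fromℚ ½ * v i e)
  midpoint e = pointwise {fractionalPoint m e} {∑ λ i → fromℚ ½ * v i e} λ n →
    trans (average (remainder {m} 4 e) n)
      (sym (cong₂ (λ x y → ½ ℚ.* seq x n ℚ.+ (½ ℚ.* seq y n ℚ.+ 0ℚ))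
        (χ-pick m true true e) (χ-pick m false true e)))

Slice : ∀ k → Vector ℝ ((2 ℕ.+ k) ℕ.* 4) → Set
Slice k = WeightSlice (straight (2 ℕ.+ k)) (twisted (2 ℕ.+ k)) (heavy k)

fractional∈Slice : ∀ k → Slice k (fractionalPoint (2 ℕ.+ k))
fractional∈Slice k = fractional∈ m (straight m) (pick-straight m) ,
  fractional∈ m (twisted m) (pick-twisted m) ,
  ≈-trans {heavy k ᵀ x} {fromℚ ½ + (0ℝ + fromℚ ½)} {1ℝ} (heavy-sum k x)
    (pointwise {fromℚ ½ + (0ℝ + fromℚ ½)} {1ℝ} λ _ → refl)
  where
  m = 2 ℕ.+ k
  x = fractionalPoint m

-- Rigidity of the slice and the vertex property

module _ (k : ℕ) (y : Vector ℝ ((2 ℕ.+ k) ℕ.* 4)) (y∈Slice : Slice k y) where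
  private
    m : ℕ
    m = 2 ℕ.+ k
    _at_ : Fin m → Fin 4 → ℝ
    i at s = y (combine i s)

  straight-sum : ∀ s i → i at s + i at mate s ≈ 1ℝ
  straight-sum s i = basePolytope-complement (straight m) {y} (proj₁ y∈Slice) λ basis →
    basis-mate (λ _ → id) (λ _ → id) basis s {i} {i} refl

  twisted-sum : ∀ s {i j} → shift s i ≡ shift (mate s) j → i at s + j at mate s ≈ 1ℝ
  twisted-sum s {i} {j} eq = basePolytope-complement (twisted m) {y} (proj₁ (proj₂ y∈Slice)) λ basis →
    basis-mate shift shift-injective basis s {i} {j} eq

  -- The values at index i+1 and at index i on `mate s` both complement the value at index i on `s`,
  -- by the second and the first matroid respectively.
  constant-along : ∀ s → (∀ i → shift s (inject₁ i) ≡ shift (mate s) (suc i)) →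
    ∀ i → i at mate s ≈ zero at mate s
  constant-along s eq = <-weakInduction (λ i → i at mate s ≈ zero at mate s)
    (≈-refl {zero at mate s}) λ i ih →
    ≈-trans {suc i at mate s} {inject₁ i at mate s} {zero at mate s}
      (+-cancelˡ (inject₁ i at s) {suc i at mate s} {inject₁ i at mate s} {1ℝ}
        (twisted-sum s (eq i)) (straight-sum s (inject₁ i)))
      ih

  Y-constant : ∀ i → i at Y ≈ zero at Y
  Y-constant = constant-along X (λ _ → refl)

  W-constant : ∀ i → i at W ≈ zero at W
  W-constant = constant-along Z (λ _ → refl)

  -- Constancy replaces Y_1 by Y_0, so the weight equation becomes Y_0 + Y_0 = 1. Vanishing at W_0
  -- is made a hypothesis so that the lemma serves both ends of a segment through the point.
  slice-rigid : zero at W ≈ 0ℝ → y ≋ fractionalPoint m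
  slice-rigid W₀≈0 e =
    subst (λ e → y e ≈ fractionalPoint m e) (combine-remQuot {m} 4 e)
      (subst (λ s → i at t ≈ fromℚ (fractional s)) (cong proj₂ (sym (remQuot-combine i t))) (value i t))
    where
    open SetoidReasoning ℝ-setoid
    i : Fin m
    i = quotient {m} 4 e
    t : Fin 4
    t = remainder {m} 4 e

    Y₀+Y₀≈1 : zero at Y + zero at Y ≈ 1ℝ
    Y₀+Y₀≈1 = begin
      zero at Y + zero at Y
        ≈⟨ pointwise {zero at Y + zero at Y} {zero at Y + (0ℝ + zero at Y)} (λ n →
             cong (seq (zero at Y) n ℚ.+_) (sym (ℚ.+-identityˡ (seq (zero at Y) n)))) ⟩
      zero at Y + (0ℝ + zero at Y)
        ≈⟨ +-cong {zero at Y} {zero at Y} {zero at W + suc zero at Y} {0ℝ + zero at Y}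
             (≈-refl {zero at Y})
             (+-cong {zero at W} {0ℝ} {suc zero at Y} {zero at Y} W₀≈0 (Y-constant (suc zero))) ⟨
      zero at Y + (zero at W + suc zero at Y)
        ≈⟨ heavy-sum k y ⟨
      heavy k ᵀ y
        ≈⟨ proj₂ (proj₂ y∈Slice) ⟩
      1ℝ ∎

    Y≈½ : ∀ i → i at Y ≈ fromℚ ½
    Y≈½ i = ≈-trans {i at Y} {zero at Y} {fromℚ ½} (Y-constant i) (x+x≈1⇒x≈½ (zero at Y) Y₀+Y₀≈1)

    W≈0 : ∀ i → i at W ≈ 0ℝ
    W≈0 i = ≈-trans {i at W} {zero at W} {0ℝ} (W-constant i) W₀≈0

    value : ∀ i s → i at s ≈ fromℚ (fractional s)
    value i X = complement-value (i at X) (i at Y) {½} {½} (straight-sum X i) (Y≈½ i) refl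
    value i Y = Y≈½ i
    value i Z = complement-value (i at Z) (i at W) {1ℚ} {0ℚ} (straight-sum Z i) (W≈0 i) refl
    value i W = W≈0 i

fractional-isVertex : ∀ k → IsVertex (Slice k) (fractionalPoint (2 ℕ.+ k))
fractional-isVertex k = fractional∈Slice k , extreme
  where
  x = fractionalPoint (2 ℕ.+ k)
  extreme : ∀ y z t → Slice k y → Slice k z → 0ℝ < t → t < 1ℝ →
    x ≋ (λ e → (1ℝ - t) * y e + t * z e) → y ≋ x × z ≋ x
  extreme y z t y∈ z∈ 0<t t<1 x≋ =
    slice-rigid k y y∈ (*-cancelˡ-0 {1ℝ - t} {y W} 0<1-t (0≤+≈0⇒≈0 {a} {b} 0≤a 0≤b a+b≈0)) ,
    slice-rigid k z z∈ (*-cancelˡ-0 {t} {z W} 0<t (0≤+≈0⇒≈0 {b} {a} 0≤b 0≤a b+a≈0))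
    where
    a b : ℝ
    a = (1ℝ - t) * y W
    b = t * z W
    0<1-t : 0ℝ < 1ℝ - t
    0<1-t = x<y⇒0<y-x {t} {1ℝ} t<1
    0≤a : 0ℝ ≤ᴿ a
    0≤a = 0≤-* {1ℝ - t} {y W} 0<1-t (basePolytope-nonneg (straight (2 ℕ.+ k)) {y} (proj₁ y∈) W)
    0≤b : 0ℝ ≤ᴿ b
    0≤b = 0≤-* {t} {z W} 0<t (basePolytope-nonneg (straight (2 ℕ.+ k)) {z} (proj₁ z∈) W)
    -- Here `W` is element number 3, that is W_0, where `fractionalPoint` evaluates to 0.
    a+b≈0 : a + b ≈ 0ℝ
    a+b≈0 = ≈-sym {0ℝ} {a + b} (x≋ W)
    b+a≈0 : b + a ≈ 0ℝ
    b+a≈0 = ≈-trans {b + a} {a + b} {0ℝ}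
      (pointwise {b + a} {a + b} λ n → ℚ.+-comm (seq b n) (seq a n)) a+b≈0

-- The distance to the basis X ∪ W

gap : Fin 4 → ℚ
gap X = ½
gap Y = ½
gap Z = 1ℚ
gap W = 1ℚ

-- Each block of four contributes 1/2 + 1/2 + 1 + 1 = 3, which is three quarters of its size.
∑-gap : ∀ m n → seq (∑ λ e → fromℚ (gap (remainder {m} 4 e))) n ≡ + 3 / 4 ℚ.* (+ (m ℕ.* 4) / 1)
∑-gap zero    n = refl
∑-gap (suc m) n = begin
  ½ ℚ.+ (½ ℚ.+ (1ℚ ℚ.+ (1ℚ ℚ.+ rest)))
    ≡⟨ solve 3 (λ h o r → h :+ (h :+ (o :+ (o :+ r))) := (h :+ (h :+ (o :+ o))) :+ r) refl ½ 1ℚ rest ⟩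
  + 3 / 1 ℚ.+ rest
    ≡⟨ cong (+ 3 / 1 ℚ.+_) (∑-gap m n) ⟩
  + 3 / 4 ℚ.* (+ 4 / 1) ℚ.+ + 3 / 4 ℚ.* (+ (m ℕ.* 4) / 1)
    ≡⟨ ℚ.*-distribˡ-+ (+ 3 / 4) (+ 4 / 1) (+ (m ℕ.* 4) / 1) ⟨
  + 3 / 4 ℚ.* (+ 4 / 1 ℚ.+ + (m ℕ.* 4) / 1)
    ≡⟨ cong (+ 3 / 4 ℚ.*_) (/1-homo-+ 4 (m ℕ.* 4)) ⟨
  + 3 / 4 ℚ.* (+ (suc m ℕ.* 4) / 1) ∎
  where
  open ≡-Reasoning
  rest : ℚ
  rest = seq (∑ λ e → fromℚ (gap (remainder {m} 4 e))) n

distance : ∀ m →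
  ‖ fractionalPoint m ⊖ χ (pick m true false) ‖₁ ≈ fromℚ (+ 3 / 4) * fromℕ (m ℕ.* 4)
distance m = begin
  ‖ x ⊖ χB ‖₁
    ≈⟨ ∑-cong {f = λ e → ∣ (x ⊖ χB) e ∣ᴿ} {gaps} entry ⟩
  ∑ gaps
    ≈⟨ pointwise {∑ gaps} {fromℚ (+ 3 / 4) * fromℕ (m ℕ.* 4)} (∑-gap m) ⟩
  fromℚ (+ 3 / 4) * fromℕ (m ℕ.* 4) ∎
  where
  open SetoidReasoning ℝ-setoid
  x χB gaps : Vector ℝ (m ℕ.* 4)
  x      = fractionalPoint m
  χB     = χ (pick m true false)
  gaps e = fromℚ (gap (remainder {m} 4 e))
  difference : ∀ s n → ℚ.∣ fractional s ℚ.- seq (if chosen true false s then 1ℝ else 0ℝ) n ∣ ≡ gap s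
  difference X n = refl
  difference Y n = refl
  difference Z n = refl
  difference W n = refl
  entry : (λ e → ∣ (x ⊖ χB) e ∣ᴿ) ≋ gaps
  entry e = pointwise {∣ (x ⊖ χB) e ∣ᴿ} {gaps e} λ n →
    trans (cong (λ c → ℚ.∣ fractional (remainder {m} 4 e) ℚ.- seq c n ∣) (χ-pick m true false e))
      (difference (remainder {m} 4 e) n)

theorem20 : ∀ (N : ℕ) → ∃[ n ] (N ≤ n ×
    (Σ[ M ∈ Matroid n ] Σ[ M′ ∈ Matroid n ] Σ[ w ∈ Weight n ] Σ[ x* ∈ Vector ℝ n ]
    ( IsVertex (WeightSlice M M′ w) x*
    × (Σ[ B! ∈ ∃! _≡_ (λ B → IsCommonBasis M M′ B × weight w B ≡ 1) ]
    ‖ x* ⊖ χ (proj₁ B!) ‖₁ ≈ fromℚ (+ 3 / 4) * fromℕ n))))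
theorem20 N = m ℕ.* 4 , ℕ.≤-trans (ℕ.m≤n+m N 2) (ℕ.m≤m*n m 4) ,
  straight m , twisted m , heavy N , fractionalPoint m , fractional-isVertex N ,
  (pick m true false ,
    ((pick-straight m true false , pick-twisted m true false) , weight-pick N true false) ,
    λ (common , weight≡1) → unique common weight≡1) ,
  distance m
  where
  m = 2 ℕ.+ N
  -- The four weights are 0, 1, 2 and 3, so weight 1 singles out one choice of `a` and `b`.
  only-weight-1 : ∀ a b → weight (heavy N) (pick m a b) ≡ 1 → pick m true false ≡ pick m a b
  only-weight-1 true  true  eq = contradiction (trans (sym (weight-pick N true true)) eq) λ()
  only-weight-1 true  false eq = refl
  only-weight-1 false true  eq = contradiction (trans (sym (weight-pick N false true)) eq) λ()
  only-weight-1 false false eq = contradiction (trans (sym (weight-pick N false false)) eq) λ()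
  -- `commonBasis⇒pick` takes the number of blocks minus one, hence `suc N` for `m = 2 ℕ.+ N`.
  unique : ∀ {B} → IsCommonBasis (straight m) (twisted m) B → weight (heavy N) B ≡ 1 →
    pick m true false ≡ B
  unique common weight≡1 = trans
    (only-weight-1 _ _
      (trans (cong (weight (heavy N)) (sym (commonBasis⇒pick (suc N) common))) weight≡1))
    (sym (commonBasis⇒pick (suc N) common))
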